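{- (1) For all $A,B,C\in\widehat{\mathbb{F}_q^\times}$ and $\lambda\in\mathbb{F}_q$, $$\mathbb{P}_D^{(1)}\left[\begin{matrix}A; & B\\ & C\end{matrix};\lambda\right]=\overline{B}(1-\lambda)\,\mathbb{P}_D^{(1)}\left[\begin{matrix}\overline{A}C; & B\\ & C\end{matrix};\frac{\lambda}{\lambda-1}\right]+\delta(1-\lambda)\,J(A,C\overline{AB})$$ $$=\overline{A}(1-\lambda)\,\mathbb{P}_D^{(1)}\left[\begin{matrix}A; & C\overline{B}\\ & C\end{matrix};\frac{\lambda}{\lambda-1}\right]+\delta(1-\lambda)\,J(A,C\overline{AB}),$$ where for $\lambda=1$ the first term in each expression is read as $0$ (since $\overline{B}(0)=\overline{A}(0)=0$). (2) Let $n\ge2$. For all $A,C,B_1,\dots,B_n\in\widehat{\mathbb{F}_q^\times}$ and $\lambda_1,\dots,\lambda_n\in\mathbb{F}_q$ with $\lambda_i\neq1$ for all $i$, $$\mathbb{P}_D^{(n)}\left[\begin{matrix}A; & B_1\ \cdots\ B_n\\ & C\end{matrix};\lambda_1,\dots,\lambda_n\right]=\left(\prod_{i=1}^n\overline{B_i}(1-\lambda_i)\right)\mathbb{P}_D^{(n)}\left[\begin{matrix}\overline{A}C; & B_1\ \cdots\ B_n\\ & C\end{matrix};\frac{\lambda_1}{\lambda_1-1},\dots,\frac{\lambda_n}{\lambda_n-1}\right].$$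
   Context: $\mathbb{F}_q$ is a finite field with $q=p^e$, $p$ an odd prime. $\widehat{\mathbb{F}_q^\times}$ is the group of complex-valued multiplicative characters of $\mathbb{F}_q^\times$; every character $\chi$, including the trivial one, is extended to $\mathbb{F}_q$ by $\chi(0)=0$, and $\overline{\chi}=\chi^{ -1}$. For $x\in\mathbb{F}_q$, $\delta(x)=1$ if $x=0$ and $\delta(x)=0$ otherwise. The Jacobi sum is $J(A,B)=\sum_{x\in\mathbb{F}_q}A(x)B(1-x)$. For $n\ge1$ the finite-field Appell-Lauricella period function is $$\mathbb{P}_D^{(n)}\left[\begin{matrix}A; & B_1\ \cdots\ B_n\\ & C\end{matrix};\lambda_1,\dots,\lambda_n\right]=\sum_{y\in\mathbb{F}_q}A(y)\,C\overline{A}(1-y)\,\overline{B_1}(1-\lambda_1y)\cdots\overline{B_n}(1-\lambda_ny).$$ -}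

module Defs where

open import Algebra.Bundles using (AbelianGroup; CommutativeRing)
open import Algebra.Definitions using (Invertible)
open import Algebra.Morphism.Bundles using (GroupHomomorphism)
import Algebra.Properties.AbelianGroup as AbelianGroupProperties
import Algebra.Properties.CommutativeMonoid.Sum as Sum
import Algebra.Properties.CommutativeSemigroup as CommutativeSemigroupProperties
open import Data.Fin.Base using (Fin)
import Data.Fin.Properties as Fin
open import Data.Nat.Base as ℕ using (ℕ)
import Data.Nat.Properties as ℕ
open import Data.Product.Base using (∃-syntax; _×_; _,_; proj₁; proj₂)
open import Data.Rational.Base as ℚ using (ℚ; 0ℚ; 1ℚ; ½; ∣_∣; Positive)
import Data.Rational.Properties as ℚ
open import Data.Rational.Solver using (module +-*-Solver)
open import Data.Vec.Functional using (Vector)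
open import Function.Bundles using (Inverse)
import Function.Properties.Inverse as Inverse
open import Level using (Level; 0ℓ; _⊔_; suc)
open import Relation.Binary.Definitions using (Decidable)
open import Relation.Binary.PropositionalEquality as ≡ using (_≡_)
open import Relation.Nullary.Decidable using (yes; no; via-injection)
open import Relation.Nullary.Negation using (¬_)

private
  variable
    c ℓ k ℓk : Level
    q n : ℕ

Small : (ℕ → ℕ → ℚ) → Set
Small f = ∀ ε → 0ℚ ℚ.< ε →
          ∃[ N ] (∀ m n → N ℕ.≤ m → N ℕ.≤ n → ∣ f m n ∣ ℚ.< ε)

-- Real numbers are Cauchy sequences of rationals.  As `Small` is a
-- Σ-type, a real number carries its modulus of convergence.
record ℝ : Set where
  constructor _#_
  field
    seq    : ℕ → ℚ
    cauchy : Small (λ m n → seq m ℚ.- seq n)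

open ℝ public

infix 4 _≈ℝ_

-- For Cauchy sequences this is equivalent to  xₙ - yₙ → 0.
_≈ℝ_ : ℝ → ℝ → Set
x ≈ℝ y = Small (λ m n → seq x m ℚ.- seq y n)

private
  Bounded : (ℕ → ℕ → ℚ) → Set
  Bounded f = ∃[ b ] Positive b ×
              ∃[ N ] (∀ m n → N ℕ.≤ m → N ℕ.≤ n → ∣ f m n ∣ ℚ.≤ b)

  small-resp : ∀ {f g} → (∀ m n → f m n ≡ g m n) → Small f → Small g
  small-resp f≡g s ε 0<ε with s ε 0<ε
  ... | N , h = N , λ m n N≤m N≤n →
    ≡.subst (λ t → ∣ t ∣ ℚ.< ε) (f≡g m n) (h m n N≤m N≤n)

  small-flip : ∀ {f} → Small f → Small (λ m n → f n m)
  small-flip s ε 0<ε with s ε 0<ε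
  ... | N , h = N , λ m n N≤m N≤n → h n m N≤n N≤m

  small-diag : ∀ {f} → Small f → Small (λ m _ → f m m)
  small-diag s ε 0<ε with s ε 0<ε
  ... | N , h = N , λ m _ N≤m _ → h m m N≤m N≤m

  small-neg : ∀ {f} → Small f → Small (λ m n → ℚ.- f m n)
  small-neg {f} s ε 0<ε with s ε 0<ε
  ... | N , h = N , λ m n N≤m N≤n →
    ≡.subst (ℚ._< ε) (≡.sym (ℚ.∣-p∣≡∣p∣ (f m n))) (h m n N≤m N≤n)

  small-+ : ∀ {f g} → Small f → Small g → Small (λ m n → f m n ℚ.+ g m n)
  small-+ {f} {g} s t ε 0<ε = N ℕ.⊔ M , λ m n p r →
    ≡.subst (∣ f m n ℚ.+ g m n ∣ ℚ.<_) halves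
      (ℚ.≤-<-trans (ℚ.∣p+q∣≤∣p∣+∣q∣ (f m n) (g m n))
        (ℚ.+-mono-< (proj₂ s′ m n (ℕ.m⊔n≤o⇒m≤o N M p) (ℕ.m⊔n≤o⇒m≤o N M r))
                    (proj₂ t′ m n (ℕ.m⊔n≤o⇒n≤o N M p) (ℕ.m⊔n≤o⇒n≤o N M r))))
    where
    0<ε/2 : 0ℚ ℚ.< ½ ℚ.* ε
    0<ε/2 = ≡.subst (ℚ._< ½ ℚ.* ε) (ℚ.*-zeroʳ ½) (ℚ.*-monoʳ-<-pos ½ 0<ε)
    halves : ½ ℚ.* ε ℚ.+ ½ ℚ.* ε ≡ ε
    halves = ≡.trans (≡.sym (ℚ.*-distribʳ-+ ε ½ ½)) (ℚ.*-identityˡ ε)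
    s′ = s (½ ℚ.* ε) 0<ε/2
    t′ = t (½ ℚ.* ε) 0<ε/2
    N = proj₁ s′
    M = proj₁ t′

  small-* : ∀ {f g} → Bounded f → Small g → Small (λ m n → f m n ℚ.* g m n)
  small-* {f} {g} (b , b>0 , N , bound) t ε 0<ε = N ℕ.⊔ M , λ m n p r →
    ≡.subst₂ ℚ._<_ (≡.sym (ℚ.∣p*q∣≡∣p∣*∣q∣ (f m n) (g m n))) cancel
      (ℚ.≤-<-trans
        (ℚ.*-monoʳ-≤-nonNeg ∣ g m n ∣ {{ℚ.∣-∣-nonNeg (g m n)}}
          (bound m n (ℕ.m⊔n≤o⇒m≤o N M p) (ℕ.m⊔n≤o⇒m≤o N M r)))
        (ℚ.*-monoʳ-<-pos b
          (proj₂ t′ m n (ℕ.m⊔n≤o⇒n≤o N M p) (ℕ.m⊔n≤o⇒n≤o N M r))))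
    where
    instance
      b-pos = b>0
      b-nonZero = ℚ.pos⇒nonZero b
      1/b-pos = ℚ.1/pos⇒pos b
    0<ε/b : 0ℚ ℚ.< ℚ.1/ b ℚ.* ε
    0<ε/b = ≡.subst (ℚ._< ℚ.1/ b ℚ.* ε) (ℚ.*-zeroʳ (ℚ.1/ b))
              (ℚ.*-monoʳ-<-pos (ℚ.1/ b) 0<ε)
    cancel : b ℚ.* (ℚ.1/ b ℚ.* ε) ≡ ε
    cancel = ≡.trans (≡.sym (ℚ.*-assoc b (ℚ.1/ b) ε))
               (≡.trans (≡.cong (ℚ._* ε) (ℚ.*-inverseʳ b)) (ℚ.*-identityˡ ε))
    t′ = t (ℚ.1/ b ℚ.* ε) 0<ε/b
    M = proj₁ t′

  seq-bounded : ∀ x → Bounded (λ m _ → seq x m)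
  seq-bounded x = 1ℚ ℚ.+ ∣ seq x N ∣
                , ℚ.pos+nonNeg⇒pos 1ℚ ∣ seq x N ∣ {{ℚ.∣-∣-nonNeg (seq x N)}}
                , N , λ m _ N≤m _ →
    ≡.subst (ℚ._≤ 1ℚ ℚ.+ ∣ seq x N ∣) (≡.cong ∣_∣ (split (seq x m) (seq x N)))
      (ℚ.≤-trans (ℚ.∣p+q∣≤∣p∣+∣q∣ (seq x m ℚ.- seq x N) (seq x N))
        (ℚ.+-monoˡ-≤ ∣ seq x N ∣
          (ℚ.<⇒≤ (proj₂ near m N N≤m ℕ.≤-refl))))
    where
    near = cauchy x 1ℚ (ℚ.positive⁻¹ 1ℚ)
    N = proj₁ near
    split : ∀ a b → (a ℚ.- b) ℚ.+ b ≡ a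
    split = solve 2 (λ a b → (a :- b) :+ b := a) ≡.refl
      where open +-*-Solver

  bounded-flip : ∀ {f} → Bounded f → Bounded (λ m n → f n m)
  bounded-flip (b , b>0 , N , h) = b , b>0 , N , λ m n p r → h n m r p

  +-small : ∀ (x x′ y y′ : ℝ) → x ≈ℝ x′ → y ≈ℝ y′ →
            Small (λ m n → (seq x m ℚ.+ seq y m) ℚ.- (seq x′ n ℚ.+ seq y′ n))
  +-small x x′ y y′ s t = small-resp
    (λ m n → solve 4 (λ a b d e → (a :- d) :+ (b :- e) := (a :+ b) :- (d :+ e))
               ≡.refl (seq x m) (seq y m) (seq x′ n) (seq y′ n))
    (small-+ s t)
    where open +-*-Solver

  *-small : ∀ (x x′ y y′ : ℝ) → x ≈ℝ x′ → y ≈ℝ y′ →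
            Small (λ m n → (seq x m ℚ.* seq y m) ℚ.- (seq x′ n ℚ.* seq y′ n))
  *-small x x′ y y′ s t = small-resp
    (λ m n → solve 4 (λ a b d e → a :* (b :- e) :+ e :* (a :- d) := (a :* b) :- (d :* e))
               ≡.refl (seq x m) (seq y m) (seq x′ n) (seq y′ n))
    (small-+ (small-* (seq-bounded x) t) (small-* (bounded-flip (seq-bounded y′)) s))
    where open +-*-Solver

  neg-small : ∀ (x x′ : ℝ) → x ≈ℝ x′ →
              Small (λ m n → (ℚ.- seq x m) ℚ.- (ℚ.- seq x′ n))
  neg-small x x′ s = small-resp
    (λ m n → solve 2 (λ a b → :- (a :- b) := (:- a) :- (:- b)) ≡.refl (seq x m) (seq x′ n))
    (small-neg s)
    where open +-*-Solver

  ≈ℝ-refl : ∀ {x} → x ≈ℝ x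
  ≈ℝ-refl {x} = cauchy x

  ≈ℝ-sym : ∀ {x y} → x ≈ℝ y → y ≈ℝ x
  ≈ℝ-sym {x} {y} s = small-resp
    (λ m n → solve 2 (λ a b → :- (a :- b) := b :- a) ≡.refl (seq x n) (seq y m))
    (small-neg (small-flip s))
    where open +-*-Solver

  ≈ℝ-trans : ∀ {x y z} → x ≈ℝ y → y ≈ℝ z → x ≈ℝ z
  ≈ℝ-trans {x} {y} {z} s t = small-resp
    (λ m n → solve 3 (λ a b d → (a :- b) :+ (b :- d) := a :- d) ≡.refl
               (seq x m) (seq y m) (seq z n))
    (small-+ (small-diag s) t)
    where open +-*-Solver

  pointwise : ∀ {x y} → (∀ i → seq x i ≡ seq y i) → x ≈ℝ y
  pointwise {x} {y} h =
    small-resp (λ m n → ≡.cong (λ t → seq x m ℚ.- t) (h n)) (cauchy x)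

infixl 6 _+ℝ_ _-ℝ_
infixl 7 _*ℝ_
infix  8 -ℝ_

_+ℝ_ _*ℝ_ : ℝ → ℝ → ℝ
x +ℝ y = (λ i → seq x i ℚ.+ seq y i) # +-small x x y y (cauchy x) (cauchy y)
x *ℝ y = (λ i → seq x i ℚ.* seq y i) # *-small x x y y (cauchy x) (cauchy y)

-ℝ_ : ℝ → ℝ
-ℝ_ x = (λ i → ℚ.- seq x i) # neg-small x x (cauchy x)

_-ℝ_ : ℝ → ℝ → ℝ
x -ℝ y = x +ℝ (-ℝ y)

fromℚ : ℚ → ℝ
fromℚ r = (λ _ → r) # λ ε 0<ε → 0 , λ _ _ _ _ →
  ≡.subst (λ t → ∣ t ∣ ℚ.< ε) (≡.sym (ℚ.+-inverseʳ r)) 0<ε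

record ℂ : Set where
  constructor _+i_
  field
    re im : ℝ

open ℂ public

infix  4 _≈ℂ_
infixl 6 _+ℂ_
infixl 7 _*ℂ_
infix  8 -ℂ_

_≈ℂ_ : ℂ → ℂ → Set
z ≈ℂ w = re z ≈ℝ re w × im z ≈ℝ im w

_+ℂ_ _*ℂ_ : ℂ → ℂ → ℂ
z +ℂ w = (re z +ℝ re w) +i (im z +ℝ im w)
z *ℂ w = (re z *ℝ re w -ℝ im z *ℝ im w) +i (re z *ℝ im w +ℝ im z *ℝ re w)

-ℂ_ : ℂ → ℂ
-ℂ z = (-ℝ re z) +i (-ℝ im z)

0ℂ 1ℂ : ℂ
0ℂ = fromℚ 0ℚ +i fromℚ 0ℚ
1ℂ = fromℚ 1ℚ +i fromℚ 0ℚ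

private
  +ℝ-cong : ∀ {x x′ y y′} → x ≈ℝ x′ → y ≈ℝ y′ → x +ℝ y ≈ℝ x′ +ℝ y′
  +ℝ-cong {x} {x′} {y} {y′} = +-small x x′ y y′

  *ℝ-cong : ∀ {x x′ y y′} → x ≈ℝ x′ → y ≈ℝ y′ → x *ℝ y ≈ℝ x′ *ℝ y′
  *ℝ-cong {x} {x′} {y} {y′} = *-small x x′ y y′

  -ℝ-cong : ∀ {x x′} → x ≈ℝ x′ → -ℝ x ≈ℝ -ℝ x′
  -ℝ-cong {x} {x′} = neg-small x x′

  pw : ∀ {z w} → (∀ i → seq (re z) i ≡ seq (re w) i) →
       (∀ i → seq (im z) i ≡ seq (im w) i) → z ≈ℂ w
  pw {z} {w} h k = pointwise {re z} {re w} h , pointwise {im z} {im w} k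

  *ℂ-comm : ∀ z w → z *ℂ w ≈ℂ w *ℂ z
  *ℂ-comm z w = pw {z *ℂ w} {w *ℂ z}
    (λ i → solve 4 (λ a b d e → a :* d :- b :* e := d :* a :- e :* b) ≡.refl
             (seq (re z) i) (seq (im z) i) (seq (re w) i) (seq (im w) i))
    (λ i → solve 4 (λ a b d e → a :* e :+ b :* d := d :* b :+ e :* a) ≡.refl
             (seq (re z) i) (seq (im z) i) (seq (re w) i) (seq (im w) i))
    where open +-*-Solver

  *ℂ-assoc : ∀ z w v → (z *ℂ w) *ℂ v ≈ℂ z *ℂ (w *ℂ v)
  *ℂ-assoc z w v = pw {(z *ℂ w) *ℂ v} {z *ℂ (w *ℂ v)}
    (λ i → solve 6 (λ a b d e f g →
               (a :* d :- b :* e) :* f :- (a :* e :+ b :* d) :* g :=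
               a :* (d :* f :- e :* g) :- b :* (d :* g :+ e :* f)) ≡.refl
             (seq (re z) i) (seq (im z) i) (seq (re w) i)
             (seq (im w) i) (seq (re v) i) (seq (im v) i))
    (λ i → solve 6 (λ a b d e f g →
               (a :* d :- b :* e) :* g :+ (a :* e :+ b :* d) :* f :=
               a :* (d :* g :+ e :* f) :+ b :* (d :* f :- e :* g)) ≡.refl
             (seq (re z) i) (seq (im z) i) (seq (re w) i)
             (seq (im w) i) (seq (re v) i) (seq (im v) i))
    where open +-*-Solver

  *ℂ-identityˡ : ∀ z → 1ℂ *ℂ z ≈ℂ z
  *ℂ-identityˡ z = pw {1ℂ *ℂ z} {z}
    (λ i → solve 2 (λ a b → con 1ℚ :* a :- con 0ℚ :* b := a) ≡.refl
             (seq (re z) i) (seq (im z) i))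
    (λ i → solve 2 (λ a b → con 1ℚ :* b :+ con 0ℚ :* a := b) ≡.refl
             (seq (re z) i) (seq (im z) i))
    where open +-*-Solver

  *ℂ-distribʳ : ∀ v z w → (z +ℂ w) *ℂ v ≈ℂ (z *ℂ v) +ℂ (w *ℂ v)
  *ℂ-distribʳ v z w = pw {(z +ℂ w) *ℂ v} {(z *ℂ v) +ℂ (w *ℂ v)}
    (λ i → solve 6 (λ a b d e f g →
               (a :+ d) :* f :- (b :+ e) :* g :=
               (a :* f :- b :* g) :+ (d :* f :- e :* g)) ≡.refl
             (seq (re z) i) (seq (im z) i) (seq (re w) i)
             (seq (im w) i) (seq (re v) i) (seq (im v) i))
    (λ i → solve 6 (λ a b d e f g →
               (a :+ d) :* g :+ (b :+ e) :* f :=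
               (a :* g :+ b :* f) :+ (d :* g :+ e :* f)) ≡.refl
             (seq (re z) i) (seq (im z) i) (seq (re w) i)
             (seq (im w) i) (seq (re v) i) (seq (im v) i))
    where open +-*-Solver

  *ℂ-cong : ∀ {z z′ w w′} → z ≈ℂ z′ → w ≈ℂ w′ → z *ℂ w ≈ℂ z′ *ℂ w′
  *ℂ-cong {a +i b} {a′ +i b′} {d +i e} {d′ +i e′} (p , p′) (r , r′) =
    +ℝ-cong {a *ℝ d} {a′ *ℝ d′} { -ℝ (b *ℝ e)} { -ℝ (b′ *ℝ e′)}
      (*ℝ-cong {a} {a′} {d} {d′} p r)
      (-ℝ-cong {b *ℝ e} {b′ *ℝ e′} (*ℝ-cong {b} {b′} {e} {e′} p′ r′)) ,
    +ℝ-cong {a *ℝ e} {a′ *ℝ e′} {b *ℝ d} {b′ *ℝ d′}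
      (*ℝ-cong {a} {a′} {e} {e′} p r′) (*ℝ-cong {b} {b′} {d} {d′} p′ r)

  +ℂ-cong : ∀ {z z′ w w′} → z ≈ℂ z′ → w ≈ℂ w′ → z +ℂ w ≈ℂ z′ +ℂ w′
  +ℂ-cong {z} {z′} {w} {w′} (p , p′) (r , r′) =
    +ℝ-cong {re z} {re z′} {re w} {re w′} p r ,
    +ℝ-cong {im z} {im z′} {im w} {im w′} p′ r′

  ≈ℂ-trans : ∀ {z w v} → z ≈ℂ w → w ≈ℂ v → z ≈ℂ v
  ≈ℂ-trans {z} {w} {v} (p , p′) (r , r′) =
    ≈ℝ-trans {re z} {re w} {re v} p r , ≈ℝ-trans {im z} {im w} {im v} p′ r′

ℂ-commutativeRing : CommutativeRing 0ℓ 0ℓ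
ℂ-commutativeRing = record
  { Carrier = ℂ
  ; _≈_ = _≈ℂ_
  ; _+_ = _+ℂ_
  ; _*_ = _*ℂ_
  ; -_ = -ℂ_
  ; 0# = 0ℂ
  ; 1# = 1ℂ
  ; isCommutativeRing = record
    { isRing = record
      { +-isAbelianGroup = record
        { isGroup = record
          { isMonoid = record
            { isSemigroup = record
              { isMagma = record
                { isEquivalence = record
                  { refl = λ {z} → ≈ℝ-refl {re z} , ≈ℝ-refl {im z}
                  ; sym = λ {z} {w} (p , r) →
                      ≈ℝ-sym {re z} {re w} p , ≈ℝ-sym {im z} {im w} r
                  ; trans = λ {z} {w} {v} → ≈ℂ-trans {z} {w} {v}
                  }
                ; ∙-cong = λ {z} {z′} {w} {w′} → +ℂ-cong {z} {z′} {w} {w′}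
                }
              ; assoc = λ z w v → pw {(z +ℂ w) +ℂ v} {z +ℂ (w +ℂ v)}
                  (λ i → ℚ.+-assoc (seq (re z) i) (seq (re w) i) (seq (re v) i))
                  (λ i → ℚ.+-assoc (seq (im z) i) (seq (im w) i) (seq (im v) i))
              }
            ; identity =
                (λ z → pw {0ℂ +ℂ z} {z} (λ i → ℚ.+-identityˡ (seq (re z) i))
                                        (λ i → ℚ.+-identityˡ (seq (im z) i))) ,
                (λ z → pw {z +ℂ 0ℂ} {z} (λ i → ℚ.+-identityʳ (seq (re z) i))
                                        (λ i → ℚ.+-identityʳ (seq (im z) i)))
            }
          ; inverse =
              (λ z → pw {(-ℂ z) +ℂ z} {0ℂ} (λ i → ℚ.+-inverseˡ (seq (re z) i))
                                           (λ i → ℚ.+-inverseˡ (seq (im z) i))) ,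
              (λ z → pw {z +ℂ (-ℂ z)} {0ℂ} (λ i → ℚ.+-inverseʳ (seq (re z) i))
                                           (λ i → ℚ.+-inverseʳ (seq (im z) i)))
          ; ⁻¹-cong = λ {z} {w} (p , r) →
              -ℝ-cong {re z} {re w} p , -ℝ-cong {im z} {im w} r
          }
        ; comm = λ z w → pw {z +ℂ w} {w +ℂ z}
            (λ i → ℚ.+-comm (seq (re z) i) (seq (re w) i))
            (λ i → ℚ.+-comm (seq (im z) i) (seq (im w) i))
        }
      ; *-cong = λ {z} {z′} {w} {w′} → *ℂ-cong {z} {z′} {w} {w′}
      ; *-assoc = *ℂ-assoc
      ; *-identity = *ℂ-identityˡ , λ z →
          ≈ℂ-trans {z *ℂ 1ℂ} {1ℂ *ℂ z} {z} (*ℂ-comm z 1ℂ) (*ℂ-identityˡ z)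
      ; distrib =
          (λ v z w →
            ≈ℂ-trans {v *ℂ (z +ℂ w)} {(z +ℂ w) *ℂ v} {(v *ℂ z) +ℂ (v *ℂ w)}
              (*ℂ-comm v (z +ℂ w))
              (≈ℂ-trans {(z +ℂ w) *ℂ v} {(z *ℂ v) +ℂ (w *ℂ v)} {(v *ℂ z) +ℂ (v *ℂ w)}
                (*ℂ-distribʳ v z w)
                (+ℂ-cong {z *ℂ v} {v *ℂ z} {w *ℂ v} {v *ℂ w} (*ℂ-comm z v) (*ℂ-comm w v)))) ,
          *ℂ-distribʳ
      }
    ; *-comm = *ℂ-comm
    }
  }

units : CommutativeRing c ℓ → AbelianGroup (c ⊔ ℓ) ℓ
units R = record
  { Carrier = ∃[ x ] Invertible _≈_ 1# _*_ x
  ; _≈_ = λ u v → proj₁ u ≈ proj₁ v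
  ; _∙_ = λ (x , x⁻¹ , xˡ , xʳ) (y , y⁻¹ , yˡ , yʳ) →
      x * y , x⁻¹ * y⁻¹ ,
      trans (interchange x⁻¹ y⁻¹ x y) (trans (*-cong xˡ yˡ) (*-identityˡ 1#)) ,
      trans (interchange x y x⁻¹ y⁻¹) (trans (*-cong xʳ yʳ) (*-identityˡ 1#))
  ; ε = 1# , 1# , *-identityˡ 1# , *-identityˡ 1#
  ; _⁻¹ = λ (x , x⁻¹ , xˡ , xʳ) → x⁻¹ , x , xʳ , xˡ
  ; isAbelianGroup = record
    { isGroup = record
      { isMonoid = record
        { isSemigroup = record
          { isMagma = record
            { isEquivalence = record { refl = refl ; sym = sym ; trans = trans }
            ; ∙-cong = *-cong
            }
          ; assoc = λ u v w → *-assoc (proj₁ u) (proj₁ v) (proj₁ w)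
          }
        ; identity = (λ u → *-identityˡ (proj₁ u)) , (λ u → *-identityʳ (proj₁ u))
        }
      ; inverse = (λ (_ , _ , xˡ , _) → xˡ) , (λ (_ , _ , _ , xʳ) → xʳ)
      ; ⁻¹-cong = λ {(x , x⁻¹ , xˡ , xʳ)} {(y , y⁻¹ , yˡ , yʳ)} x≈y →
          trans (sym (*-identityʳ x⁻¹))
            (trans (*-congˡ (trans (sym yʳ) (*-congʳ (sym x≈y))))
              (trans (sym (*-assoc x⁻¹ x y⁻¹))
                (trans (*-congʳ xˡ) (*-identityˡ y⁻¹))))
      }
    ; comm = λ u v → *-comm (proj₁ u) (proj₁ v)
    }
  }
  where
  open CommutativeRing R
  open CommutativeSemigroupProperties *-commutativeSemigroup using (interchange)

record FiniteField (c ℓ : Level) (q : ℕ) : Set (suc (c ⊔ ℓ)) where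
  field
    commutativeRing : CommutativeRing c ℓ

  open CommutativeRing commutativeRing public

  field
    0≉1           : ¬ (0# ≈ 1#)
    ≉0⇒invertible : ∀ {x} → ¬ (x ≈ 0#) → Invertible _≈_ 1# _*_ x
    enumeration   : Inverse (≡.setoid (Fin q)) setoid

  infix 4 _≟_

  _≟_ : Decidable _≈_
  _≟_ = via-injection (Inverse.Inverse⇒Injection (Inverse.sym enumeration)) Fin._≟_

  infixl 7 _/_

  -- Division is made total by  x / 0 = 0.
  _/_ : Carrier → Carrier → Carrier
  x / y with y ≟ 0#
  ... | yes _   = 0#
  ... | no  y≉0 = x * proj₁ (≉0⇒invertible y≉0)

-- The values are taken in an arbitrary K so that proofs need not unfold ℂ.
-- Characters in the usual sense are the case K = ℂ.
module Characters (𝔽 : FiniteField c ℓ q) (K : CommutativeRing k ℓk) where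

  private
    module F = FiniteField 𝔽
    module K = CommutativeRing K

    𝔽× = units F.commutativeRing
    K× = units K

    module 𝔽× = AbelianGroup 𝔽×
    module K× = AbelianGroup K×

  Character : Set (c ⊔ ℓ ⊔ k ⊔ ℓk)
  Character = GroupHomomorphism 𝔽×.rawGroup K×.rawGroup

  -- A ⁻¹ is the character commonly written Ā.
  infixl 7 _·_
  infix 10 _⁻¹

  _·_ : Character → Character → Character
  A · B = record
    { ⟦_⟧ = λ u → A.⟦ u ⟧ K×.∙ B.⟦ u ⟧
    ; isGroupHomomorphism = record
      { isMonoidHomomorphism = record
        { isMagmaHomomorphism = record
          { isRelHomomorphism = record
            { cong = λ {u} {v} u≈v →
                K×.∙-cong {A.⟦ u ⟧} {A.⟦ v ⟧} {B.⟦ u ⟧} {B.⟦ v ⟧}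
                  (A.⟦⟧-cong u≈v) (B.⟦⟧-cong u≈v) }
          ; homo = λ u v → K.trans (K.*-cong (A.homo u v) (B.homo u v))
              (interchange (proj₁ A.⟦ u ⟧) (proj₁ A.⟦ v ⟧) (proj₁ B.⟦ u ⟧) (proj₁ B.⟦ v ⟧))
          }
        ; ε-homo = K.trans (K.*-cong A.ε-homo B.ε-homo) (K.*-identityˡ K.1#)
        }
      ; ⁻¹-homo = λ u → K.trans (K.*-cong (A.⁻¹-homo u) (B.⁻¹-homo u))
          (AbelianGroupProperties.⁻¹-∙-comm K× A.⟦ u ⟧ B.⟦ u ⟧)
      }
    }
    where
    module A = GroupHomomorphism A
    module B = GroupHomomorphism B
    open CommutativeSemigroupProperties K.*-commutativeSemigroup using (interchange)

  _⁻¹ : Character → Character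
  A ⁻¹ = record
    { ⟦_⟧ = λ u → A.⟦ u ⟧ K×.⁻¹
    ; isGroupHomomorphism = record
      { isMonoidHomomorphism = record
        { isMagmaHomomorphism = record
          { isRelHomomorphism = record
            { cong = λ {u} {v} u≈v →
                K×.⁻¹-cong {A.⟦ u ⟧} {A.⟦ v ⟧} (A.⟦⟧-cong u≈v) }
          ; homo = λ u v → K.trans
              (K×.⁻¹-cong {A.⟦ u 𝔽×.∙ v ⟧} {A.⟦ u ⟧ K×.∙ A.⟦ v ⟧} (A.homo u v))
              K.refl
          }
        ; ε-homo = K×.⁻¹-cong {A.⟦ 𝔽×.ε ⟧} {K×.ε} A.ε-homo
        }
      ; ⁻¹-homo = λ u → K×.⁻¹-cong {A.⟦ u 𝔽×.⁻¹ ⟧} {A.⟦ u ⟧ K×.⁻¹} (A.⁻¹-homo u)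
      }
    }
    where
    module A = GroupHomomorphism A

  infix 9 _⟨_⟩

  -- The extension of χ to 𝔽 by χ(0) = 0, for trivial χ as well.
  _⟨_⟩ : Character → F.Carrier → K.Carrier
  χ ⟨ x ⟩ with x F.≟ F.0#
  ... | yes _   = K.0#
  ... | no  x≉0 = proj₁ (GroupHomomorphism.⟦_⟧ χ (x , F.≉0⇒invertible x≉0))

  δ : F.Carrier → K.Carrier
  δ x with x F.≟ F.0#
  ... | yes _ = K.1#
  ... | no  _ = K.0#

  ∑𝔽 : (F.Carrier → K.Carrier) → K.Carrier
  ∑𝔽 f = Sum.sum K.+-commutativeMonoid (λ i → f (Inverse.to F.enumeration i))

  ∏ : Vector K.Carrier n → K.Carrier
  ∏ = Sum.sum K.*-commutativeMonoid

  J : Character → Character → K.Carrier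
  J A B = ∑𝔽 λ x → A ⟨ x ⟩ K.* B ⟨ F.1# F.- x ⟩

  ℙᴰ : Character → Vector Character n → Character → Vector F.Carrier n → K.Carrier
  ℙᴰ A B C l = ∑𝔽 λ y →
    A ⟨ y ⟩ K.* (C · A ⁻¹) ⟨ F.1# F.- y ⟩ K.* ∏ λ i → (B i) ⁻¹ ⟨ F.1# F.- l i F.* y ⟩

{-# OPTIONS --safe #-}
module Submission where

open import Defs
open import Algebra.Bundles using (AbelianGroup; CommutativeRing)
open import Algebra.Core using (Op₂)
open import Algebra.Morphism.Bundles using (GroupHomomorphism)
import Algebra.Properties.AbelianGroup as AbelianGroupProperties
import Algebra.Properties.CommutativeMonoid.Sum as Sum
import Algebra.Properties.Ring as RingProperties
import Algebra.Properties.Semiring.Sum as SemiringSum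
import Algebra.Solver.CommutativeMonoid as CommutativeMonoidSolver
open import Data.Fin.Base using (zero)
open import Data.Fin.Permutation using (Permutation′; permutation)
open import Data.Nat.Base using (ℕ; _^_; _≥_)
open import Data.Nat.Divisibility using (_∣_)
open import Data.Nat.Primality using (Prime)
open import Data.Product.Base using (_×_; _,_; proj₁; proj₂)
open import Data.Vec.Functional using (Vector; []; _∷_)
open import Function.Base using (_∘_; case_of_)
open import Function.Bundles using (Inverse)
open import Level using (Level; 0ℓ)
open import Relation.Binary.Core using (Rel)
open import Relation.Binary.PropositionalEquality as ≡ using (_≡_)
import Relation.Binary.Reasoning.Setoid as SetoidReasoning
open import Relation.Nullary.Decidable using (yes; no)
open import Relation.Nullary.Negation using (¬_; contradiction)

-- Both transformations are changes of variable by an involution of 𝔽 in the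
-- defining sum: y ↦ 1 - y for the first, and for the second the Möbius map
-- y ↦ (1 - y) / (1 - m y) with m = l / (l - 1).  The pole y = 1 / m of the
-- latter may be declared a fixed point, since both summands vanish there.
-- For l = 1 all three expressions of the case n = 1 reduce to the Jacobi sum.

-- Arithmetic in a finite field.

module FieldProperties {c ℓ : Level} {q : ℕ} (𝔽 : FiniteField c ℓ q) where

  open FiniteField 𝔽
  open RingProperties ring
  open SetoidReasoning setoid

  x-y≈0⇒x≈y : ∀ {x y} → x - y ≈ 0# → x ≈ y
  x-y≈0⇒x≈y = x∙y⁻¹≈ε⇒x≈y _ _

  1-x≉0⇒x≉1 : ∀ {x} → ¬ (1# - x ≈ 0#) → ¬ (x ≈ 1#)
  1-x≉0⇒x≉1 1-x≉0 x≈1 = 1-x≉0 (x≈y⇒x∙y⁻¹≈ε (sym x≈1))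

  -‿cong₂ : ∀ {x x′ y y′} → x ≈ x′ → y ≈ y′ → x - y ≈ x′ - y′
  -‿cong₂ x≈x′ y≈y′ = +-cong x≈x′ (-‿cong y≈y′)

  [x-y]+[y-z]≈x-z : ∀ x y z → (x - y) + (y - z) ≈ x - z
  [x-y]+[y-z]≈x-z x y z = trans (+-assoc x (- y) (y - z)) (+-congˡ (\\-leftDividesʳ y (- z)))

  [x-y]-[x-z]≈z-y : ∀ x y z → (x - y) - (x - z) ≈ z - y
  [x-y]-[x-z]≈z-y x y z = begin
    (x - y) - (x - z)  ≈⟨ +-congˡ (⁻¹-anti-homo‿- x z) ⟩
    (x - y) + (z - x)  ≈⟨ +-comm (x - y) (z - x) ⟩
    (z - x) + (x - y)  ≈⟨ [x-y]+[y-z]≈x-z z x y ⟩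
    z - y              ∎

  [x-y]-[z-y]≈x-z : ∀ x y z → (x - y) - (z - y) ≈ x - z
  [x-y]-[z-y]≈x-z x y z = trans (+-congˡ (⁻¹-anti-homo‿- z y)) ([x-y]+[y-z]≈x-z x y z)

  1-[1-x]≈x : ∀ x → 1# - (1# - x) ≈ x
  1-[1-x]≈x x = begin
    1# - (1# - x)  ≈⟨ ⁻¹-anti-homo‿- (1# - x) 1# ⟨
    - ((1# - x) - 1#)  ≈⟨ -‿cong (trans (+-congʳ (+-comm 1# (- x))) (//-rightDividesʳ 1# (- x))) ⟩
    - - x          ≈⟨ -‿involutive x ⟩
    x              ∎

  *-cancelʳ-≉0 : ∀ {x y z} → ¬ (z ≈ 0#) → x * z ≈ y * z → x ≈ y
  *-cancelʳ-≉0 {x} {y} {z} z≉0 xz≈yz = begin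
    x              ≈⟨ */z x ⟨
    x * z * z⁻¹    ≈⟨ *-congʳ xz≈yz ⟩
    y * z * z⁻¹    ≈⟨ */z y ⟩
    y              ∎
    where
    z⁻¹ = proj₁ (≉0⇒invertible z≉0)
    */z : ∀ w → w * z * z⁻¹ ≈ w
    */z w = trans (*-assoc w z z⁻¹)
      (trans (*-congˡ (proj₂ (proj₂ (≉0⇒invertible z≉0)))) (*-identityʳ w))

  *-≉0 : ∀ {x y} → ¬ (x ≈ 0#) → ¬ (y ≈ 0#) → ¬ (x * y ≈ 0#)
  *-≉0 x≉0 y≉0 xy≈0 = x≉0 (*-cancelʳ-≉0 y≉0 (trans xy≈0 (sym (zeroˡ _))))

  x*y≈1⇒x≉0 : ∀ {x y} → x * y ≈ 1# → ¬ (x ≈ 0#)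
  x*y≈1⇒x≉0 xy≈1 x≈0 = 0≉1 (trans (sym (zeroˡ _)) (trans (*-congʳ (sym x≈0)) xy≈1))

  x*y≈1⇒y≉0 : ∀ {x y} → x * y ≈ 1# → ¬ (y ≈ 0#)
  x*y≈1⇒y≉0 xy≈1 = x*y≈1⇒x≉0 (trans (*-comm _ _) xy≈1)

  x/y*y≈x : ∀ {x y} → ¬ (y ≈ 0#) → x / y * y ≈ x
  x/y*y≈x {x} {y} y≉0 with y ≟ 0#
  ... | yes y≈0  = contradiction y≈0 y≉0
  ... | no  y≉0′ = trans (*-assoc x _ y)
    (trans (*-congˡ (proj₁ (proj₂ (≉0⇒invertible y≉0′)))) (*-identityʳ x))

  -- With m = l / (l - 1) one has (1 - l) m = - l, so the left side expands to 1 - l + l y. This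
  -- identity makes each B-factor split under y ↦ 1 - y.
  [1-l][1-l/[l-1]*y]≈1-l[1-y] : ∀ {l} → ¬ (l ≈ 1#) → ∀ y →
    (1# - l) * (1# - l / (l - 1#) * y) ≈ 1# - l * (1# - y)
  [1-l][1-l/[l-1]*y]≈1-l[1-y] {l} l≉1 y = begin
    (1# - l) * (1# - m * y)             ≈⟨ x[y-z]≈xy-xz (1# - l) 1# (m * y) ⟩
    (1# - l) * 1# - (1# - l) * (m * y)  ≈⟨ -‿cong₂ (*-identityʳ (1# - l)) (sym (*-assoc (1# - l) m y)) ⟩
    (1# - l) - (1# - l) * m * y         ≈⟨ +-congˡ (-‿cong (*-congʳ [1-l]m≈-l)) ⟩
    (1# - l) - - l * y                  ≈⟨ +-congˡ (-‿cong (-‿distribˡ-* l y)) ⟨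
    (1# - l) - - (l * y)                ≈⟨ +-congˡ (-‿involutive (l * y)) ⟩
    (1# - l) + l * y                    ≈⟨ +-assoc 1# (- l) (l * y) ⟩
    1# + (- l + l * y)                  ≈⟨ +-congˡ (+-comm (- l) (l * y)) ⟩
    1# + (l * y - l)                    ≈⟨ +-congˡ (⁻¹-anti-homo‿- l (l * y)) ⟨
    1# - (l - l * y)                    ≈⟨ +-congˡ (-‿cong (+-congʳ (*-identityʳ l))) ⟨
    1# - (l * 1# - l * y)               ≈⟨ +-congˡ (-‿cong (x[y-z]≈xy-xz l 1# y)) ⟨
    1# - l * (1# - y)                   ∎
    where
    m = l / (l - 1#)
    [1-l]m≈-l : (1# - l) * m ≈ - l
    [1-l]m≈-l = begin
      (1# - l) * m      ≈⟨ *-congʳ (⁻¹-anti-homo‿- l 1#) ⟨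
      - (l - 1#) * m    ≈⟨ -‿distribˡ-* (l - 1#) m ⟨
      - ((l - 1#) * m)  ≈⟨ -‿cong (*-comm (l - 1#) m) ⟩
      - (m * (l - 1#))  ≈⟨ -‿cong (x/y*y≈x (l≉1 ∘ x-y≈0⇒x≈y)) ⟩
      - l               ∎

  -- The case y = 1 of the previous identity. It shows that 1 - m is nonzero for m = l / (l - 1),
  -- which the Möbius substitution requires.
  [1-l][1-l/[l-1]]≈1 : ∀ {l} → ¬ (l ≈ 1#) → (1# - l) * (1# - l / (l - 1#)) ≈ 1#
  [1-l][1-l/[l-1]]≈1 {l} l≉1 = begin
    (1# - l) * (1# - m)       ≈⟨ *-congˡ (+-congˡ (-‿cong (*-identityʳ m))) ⟨
    (1# - l) * (1# - m * 1#)  ≈⟨ [1-l][1-l/[l-1]*y]≈1-l[1-y] l≉1 1# ⟩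
    1# - l * (1# - 1#)        ≈⟨ +-congˡ (-‿cong (trans (*-congˡ (-‿inverseʳ 1#)) (zeroʳ l))) ⟩
    1# - 0#                   ≈⟨ trans (+-congˡ -0#≈0#) (+-identityʳ 1#) ⟩
    1#                        ∎
    where m = l / (l - 1#)

  -- The Möbius involution and its pole.

  module Möbius (m : Carrier) (1-m≉0 : ¬ (1# - m ≈ 0#)) where

    denom : Carrier → Carrier
    denom y = 1# - m * y

    denom-cong : ∀ {x y} → x ≈ y → denom x ≈ denom y
    denom-cong x≈y = +-congˡ (-‿cong (*-congˡ x≈y))

    -- The matrix of the map has rows (-1, 1) and (-m, 1). Its trace 0 makes it an involution, and
    -- its determinant m - 1 is nonzero by `1-m≉0`.
    σ : Carrier → Carrier
    σ y with denom y ≟ 0#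
    ... | yes _ = y
    ... | no  _ = (1# - y) / denom y

    σ-pole : ∀ {y} → denom y ≈ 0# → σ y ≈ y
    σ-pole {y} d≈0 with denom y ≟ 0#
    ... | yes _   = refl
    ... | no  d≉0 = contradiction d≈0 d≉0

    σ*denom : ∀ {y} → ¬ (denom y ≈ 0#) → σ y * denom y ≈ 1# - y
    σ*denom {y} d≉0 with denom y ≟ 0#
    ... | yes d≈0 = contradiction d≈0 d≉0
    ... | no  _   = x/y*y≈x d≉0

    σ-cong : ∀ {x y} → x ≈ y → σ x ≈ σ y
    σ-cong {x} {y} x≈y with denom x ≟ 0#
    ... | yes d≈0 = trans x≈y (sym (σ-pole (trans (denom-cong (sym x≈y)) d≈0)))
    ... | no  d≉0 = *-cancelʳ-≉0 d≉0 (begin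
      (1# - x) / denom x * denom x  ≈⟨ x/y*y≈x d≉0 ⟩
      1# - x                        ≈⟨ -‿cong₂ refl x≈y ⟩
      1# - y                        ≈⟨ σ*denom (d≉0 ∘ trans (denom-cong x≈y)) ⟨
      σ y * denom y                 ≈⟨ *-congˡ (denom-cong x≈y) ⟨
      σ y * denom x                 ∎)

    -- The numerator of 1 - `σ` y is (1 - m y) - (1 - y) = y (1 - m). It determines the argument of
    -- the second character after the substitution.
    [1-σ]*denom : ∀ {y} → ¬ (denom y ≈ 0#) → (1# - σ y) * denom y ≈ y * (1# - m)
    [1-σ]*denom {y} d≉0 = begin
      (1# - σ y) * denom y            ≈⟨ [y-z]x≈yx-zx (denom y) 1# (σ y) ⟩
      1# * denom y - σ y * denom y    ≈⟨ -‿cong₂ (*-identityˡ (denom y)) (σ*denom d≉0) ⟩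
      (1# - m * y) - (1# - y)         ≈⟨ [x-y]-[x-z]≈z-y 1# (m * y) y ⟩
      y - m * y                       ≈⟨ -‿cong₂ (*-identityʳ y) (*-comm y m) ⟨
      y * 1# - y * m                  ≈⟨ x[y-z]≈xy-xz y 1# m ⟨
      y * (1# - m)                    ∎

    -- The terms m y cancel. Since 1 - m is nonzero, `σ` sends no regular point to the pole.
    denom-σ : ∀ {y} → ¬ (denom y ≈ 0#) → denom (σ y) * denom y ≈ 1# - m
    denom-σ {y} d≉0 = begin
      (1# - m * σ y) * denom y          ≈⟨ [y-z]x≈yx-zx (denom y) 1# (m * σ y) ⟩
      1# * denom y - m * σ y * denom y  ≈⟨ -‿cong₂ (*-identityˡ (denom y)) (*-assoc m (σ y) (denom y)) ⟩
      denom y - m * (σ y * denom y)     ≈⟨ -‿cong₂ refl (*-congˡ (σ*denom d≉0)) ⟩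
      denom y - m * (1# - y)            ≈⟨ -‿cong₂ refl (x[y-z]≈xy-xz m 1# y) ⟩
      denom y - (m * 1# - m * y)        ≈⟨ [x-y]-[z-y]≈x-z 1# (m * y) (m * 1#) ⟩
      1# - m * 1#                       ≈⟨ -‿cong₂ refl (*-identityʳ m) ⟩
      1# - m                            ∎

    -- Off the pole, y * `denom` (`σ` y) and 1 - `σ` y both become y (1 - m) when multiplied by
    -- `denom` y, so they agree. Cancelling `denom` (`σ` y) then gives the claim.
    σ-involutive : ∀ y → σ (σ y) ≈ y
    σ-involutive y = case denom y ≟ 0# of λ where
        (yes d≈0) → trans (σ-cong (σ-pole d≈0)) (σ-pole d≈0)
        (no  d≉0) → *-cancelʳ-≉0 (denom-σ≉0 d≉0)
          (trans (σ*denom (denom-σ≉0 d≉0)) (sym (*-cancelʳ-≉0 d≉0 (y*denom-σ d≉0))))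
      where
      denom-σ≉0 : ¬ (denom y ≈ 0#) → ¬ (denom (σ y) ≈ 0#)
      denom-σ≉0 d≉0 dσ≈0 =
        1-m≉0 (trans (sym (denom-σ d≉0)) (trans (*-congʳ dσ≈0) (zeroˡ (denom y))))
      y*denom-σ : ¬ (denom y ≈ 0#) → y * denom (σ y) * denom y ≈ (1# - σ y) * denom y
      y*denom-σ d≉0 = trans (*-assoc y (denom (σ y)) (denom y))
        (trans (*-congˡ (denom-σ d≉0)) (sym ([1-σ]*denom d≉0)))

-- Multiplicative characters extended by zero.

module CharacterSums
  {c ℓ k ℓk : Level} {q : ℕ} (𝔽 : FiniteField c ℓ q) (K : CommutativeRing k ℓk) where

  private
    module F where
      open FiniteField 𝔽 public
      open FieldProperties 𝔽 public
    module K where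
      open CommutativeRing K public
      open SemiringSum semiring public using (*-distribˡ-sum; sum-cong-≋; sum-permute)
    module ∏ = Sum K.*-commutativeMonoid
    module K× = AbelianGroup (units K)
    module K×ₚ = AbelianGroupProperties (units K)

  open Characters 𝔽 K
  open K using (_≈_; _*_; _+_)
  open F using (Carrier; 0#; 1#; _-_)
  open SetoidReasoning K.setoid

  open GroupHomomorphism using (⟦_⟧; ⟦⟧-cong; homo; ε-homo)

  ⟨⟩-zero : ∀ χ {x} → x F.≈ 0# → χ ⟨ x ⟩ ≈ K.0#
  ⟨⟩-zero χ {x} x≈0 with x F.≟ 0#
  ... | yes _   = K.refl
  ... | no  x≉0 = contradiction x≈0 x≉0

  ⟨⟩-cong : ∀ χ {x y} → x F.≈ y → χ ⟨ x ⟩ ≈ χ ⟨ y ⟩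
  ⟨⟩-cong χ {x} {y} x≈y with x F.≟ 0# | y F.≟ 0#
  ... | yes _   | yes _   = K.refl
  ... | yes x≈0 | no  y≉0 = contradiction (F.trans (F.sym x≈y) x≈0) y≉0
  ... | no  x≉0 | yes y≈0 = contradiction (F.trans x≈y y≈0) x≉0
  ... | no  _   | no  _   = ⟦⟧-cong χ x≈y

  -- Every extended character is 0 at 0, the trivial one included, so identities between characters
  -- need checking only in the group of units.
  ⟨⟩-ext : ∀ χ ψ → (∀ u → ⟦ χ ⟧ u K×.≈ ⟦ ψ ⟧ u) →
           ∀ x → χ ⟨ x ⟩ ≈ ψ ⟨ x ⟩
  ⟨⟩-ext χ ψ χ≗ψ x with x F.≟ 0#
  ... | yes _ = K.refl
  ... | no  _ = χ≗ψ _

  ⟨⟩-homo : ∀ χ x y → χ ⟨ x F.* y ⟩ ≈ χ ⟨ x ⟩ * χ ⟨ y ⟩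
  ⟨⟩-homo χ x y with x F.≟ 0# | y F.≟ 0# | (x F.* y) F.≟ 0#
  ... | yes _   | _       | yes _    = K.sym (K.zeroˡ _)
  ... | no  _   | yes _   | yes _    = K.sym (K.zeroʳ _)
  ... | yes x≈0 | _       | no  xy≉0 = contradiction (F.trans (F.*-congʳ x≈0) (F.zeroˡ y)) xy≉0
  ... | no  _   | yes y≈0 | no  xy≉0 = contradiction (F.trans (F.*-congˡ y≈0) (F.zeroʳ x)) xy≉0
  ... | no  x≉0 | no  y≉0 | yes xy≈0 = contradiction xy≈0 (F.*-≉0 x≉0 y≉0)
  ... | no  x≉0 | no  y≉0 | no  xy≉0 =
    -- The inverse chosen for x * y need not be the product of the chosen inverses, but equality in
    -- `units` compares only the underlying elements.
    K.trans (⟦⟧-cong χ F.refl)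
      (homo χ (x , F.≉0⇒invertible x≉0) (y , F.≉0⇒invertible y≉0))

  ·-⟨⟩ : ∀ χ ψ x → (χ · ψ) ⟨ x ⟩ ≈ χ ⟨ x ⟩ * ψ ⟨ x ⟩
  ·-⟨⟩ χ ψ x with x F.≟ 0#
  ... | yes _ = K.sym (K.zeroˡ K.0#)
  ... | no  _ = K.refl

  ·-comm : ∀ χ ψ x → (χ · ψ) ⟨ x ⟩ ≈ (ψ · χ) ⟨ x ⟩
  ·-comm χ ψ = ⟨⟩-ext (χ · ψ) (ψ · χ) (λ _ → K.*-comm _ _)

  -- For χ = C and ψ = A this identifies the second character of the transformed summand, whose
  -- first parameter is `A ⁻¹ · C`.
  χ·[ψ⁻¹·χ]⁻¹ : ∀ χ ψ x → (χ · (ψ ⁻¹ · χ) ⁻¹) ⟨ x ⟩ ≈ ψ ⟨ x ⟩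
  χ·[ψ⁻¹·χ]⁻¹ χ ψ = ⟨⟩-ext (χ · (ψ ⁻¹ · χ) ⁻¹) ψ λ u →
    K.trans (K.sym (K.*-assoc _ _ _)) (K×ₚ.xyx⁻¹≈y (⟦ χ ⟧ u) (⟦ ψ ⟧ u))

  -- Used with ψ = A, χ = C, φ = B to trade the B-factor for the three characters that the Möbius
  -- substitution produces.
  ψ⁻¹·[χ·ψ⁻¹]⁻¹·[χ·φ⁻¹] : ∀ χ ψ φ x →
    (ψ ⁻¹ · ((χ · ψ ⁻¹) ⁻¹ · (χ · φ ⁻¹))) ⟨ x ⟩ ≈ φ ⁻¹ ⟨ x ⟩
  ψ⁻¹·[χ·ψ⁻¹]⁻¹·[χ·φ⁻¹] χ ψ φ =
    ⟨⟩-ext (ψ ⁻¹ · ((χ · ψ ⁻¹) ⁻¹ · (χ · φ ⁻¹))) (φ ⁻¹) λ u →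
      cancel (⟦ ψ ⟧ u) (⟦ χ ⟧ u) (⟦ φ ⟧ u)
    where
    open CommutativeMonoidSolver K.*-commutativeMonoid using (solve; _⊕_; _⊜_)
    cancel : ∀ a c b → a K×.⁻¹ K×.∙ ((c K×.∙ a K×.⁻¹) K×.⁻¹ K×.∙ (c K×.∙ b K×.⁻¹)) K×.≈ b K×.⁻¹
    cancel a@(x , x⁻¹ , _) c@(z , z⁻¹ , _) b@(_ , y⁻¹ , _) = begin
      -- Inversion in `units` swaps an element with its stored inverse, so the inverse of c a⁻¹ is
      -- z⁻¹ * x by definition. The solver treats stored inverses as independent atoms.
      x⁻¹ * ((z⁻¹ * x) * (z * y⁻¹))
        ≈⟨ solve 5 (λ x x⁻¹ z z⁻¹ y⁻¹ → x⁻¹ ⊕ ((z⁻¹ ⊕ x) ⊕ (z ⊕ y⁻¹)) ⊜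
                                        x⁻¹ ⊕ (x ⊕ (z⁻¹ ⊕ (z ⊕ y⁻¹)))) K.refl x x⁻¹ z z⁻¹ y⁻¹ ⟩
      x⁻¹ * (x * (z⁻¹ * (z * y⁻¹)))  ≈⟨ K×ₚ.\\-leftDividesʳ a (c K×.⁻¹ K×.∙ (c K×.∙ b K×.⁻¹)) ⟩
      z⁻¹ * (z * y⁻¹)                ≈⟨ K×ₚ.\\-leftDividesʳ c (b K×.⁻¹) ⟩
      y⁻¹                            ∎

  ⟨⟩-inverse : ∀ χ {x} → ¬ (x F.≈ 0#) → χ ⟨ x ⟩ * χ ⁻¹ ⟨ x ⟩ ≈ K.1#
  ⟨⟩-inverse χ {x} x≉0 with x F.≟ 0#
  ... | yes x≈0  = contradiction x≈0 x≉0
  ... | no  x≉0′ = K×.inverseʳ (⟦ χ ⟧ (x , F.≉0⇒invertible x≉0′))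

  -- Evaluates χ at z / y from a relation cleared of denominators, the form in which the facts about
  -- `σ` are stated. Only y has to be nonzero.
  ⟨⟩-quotient : ∀ χ {x y z} → ¬ (y F.≈ 0#) → x F.* y F.≈ z → χ ⟨ x ⟩ ≈ χ ⟨ z ⟩ * χ ⁻¹ ⟨ y ⟩
  ⟨⟩-quotient χ {x} {y} {z} y≉0 xy≈z = begin
    χ ⟨ x ⟩                          ≈⟨ K.*-identityʳ (χ ⟨ x ⟩) ⟨
    χ ⟨ x ⟩ * K.1#                   ≈⟨ K.*-congˡ (⟨⟩-inverse χ y≉0) ⟨
    χ ⟨ x ⟩ * (χ ⟨ y ⟩ * χ ⁻¹ ⟨ y ⟩)  ≈⟨ K.*-assoc (χ ⟨ x ⟩) (χ ⟨ y ⟩) (χ ⁻¹ ⟨ y ⟩) ⟨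
    χ ⟨ x ⟩ * χ ⟨ y ⟩ * χ ⁻¹ ⟨ y ⟩    ≈⟨ K.*-congʳ (⟨⟩-homo χ x y) ⟨
    χ ⟨ x F.* y ⟩ * χ ⁻¹ ⟨ y ⟩        ≈⟨ K.*-congʳ (⟨⟩-cong χ xy≈z) ⟩
    χ ⟨ z ⟩ * χ ⁻¹ ⟨ y ⟩              ∎

  ⟨1⟩≈1 : ∀ χ → χ ⟨ 1# ⟩ ≈ K.1#
  ⟨1⟩≈1 χ with 1# F.≟ 0#
  ... | yes 1≈0 = contradiction (F.sym 1≈0) F.0≉1
  ... | no  _   = K.trans (⟦⟧-cong χ F.refl) (ε-homo χ)

  ⁻¹-⟨⟩ : ∀ χ {x y} → x F.* y F.≈ 1# → χ ⁻¹ ⟨ x ⟩ ≈ χ ⟨ y ⟩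
  ⁻¹-⟨⟩ χ {x} {y} xy≈1 = begin
    χ ⁻¹ ⟨ x ⟩                      ≈⟨ ⟨⟩-quotient (χ ⁻¹) (F.x*y≈1⇒y≉0 xy≈1) xy≈1 ⟩
    χ ⁻¹ ⟨ 1# ⟩ * (χ ⁻¹) ⁻¹ ⟨ y ⟩
      ≈⟨ K.*-cong (⟨1⟩≈1 (χ ⁻¹)) (⟨⟩-ext ((χ ⁻¹) ⁻¹) χ (λ _ → K.refl) y) ⟩
    K.1# * χ ⟨ y ⟩                  ≈⟨ K.*-identityˡ (χ ⟨ y ⟩) ⟩
    χ ⟨ y ⟩                         ∎

  -- The function `δ` and reindexing of sums over the field.

  δ-zero : ∀ {x} → x F.≈ 0# → δ x ≈ K.1#
  δ-zero {x} x≈0 with x F.≟ 0#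
  ... | yes _   = K.refl
  ... | no  x≉0 = contradiction x≈0 x≉0

  δ-nonzero : ∀ {x} → ¬ (x F.≈ 0#) → δ x ≈ K.0#
  δ-nonzero {x} x≉0 with x F.≟ 0#
  ... | yes x≈0 = contradiction x≈0 x≉0
  ... | no  _   = K.refl

  ∑𝔽-cong : ∀ {f g} → (∀ x → f x ≈ g x) → ∑𝔽 f ≈ ∑𝔽 g
  ∑𝔽-cong f≗g = K.sum-cong-≋ (f≗g ∘ Inverse.to F.enumeration)

  *-distribˡ-∑𝔽 : ∀ x f → x * ∑𝔽 f ≈ ∑𝔽 (λ y → x * f y)
  *-distribˡ-∑𝔽 x f = K.*-distribˡ-sum x (f ∘ Inverse.to F.enumeration)

  -- Transporting `σ` along the enumeration gives a self-inverse map of the index set, hence a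
  -- permutation of the summands. The congruence of f absorbs the round trip through the
  -- enumeration.
  ∑𝔽-involution : ∀ {f σ} → (∀ {x y} → x F.≈ y → f x ≈ f y) →
                  (∀ {x y} → x F.≈ y → σ x F.≈ σ y) → (∀ x → σ (σ x) F.≈ x) →
                  ∑𝔽 f ≈ ∑𝔽 (f ∘ σ)
  ∑𝔽-involution {f} {σ} f-cong σ-cong σσ≗id =
    K.trans (K.sum-permute (f ∘ to) π) (K.sum-cong-≋ (λ i → f-cong (strictlyInverseˡ (σ (to i)))))
    where
    open Inverse F.enumeration using (to; from; from-cong; strictlyInverseˡ; strictlyInverseʳ)
    π→ = from ∘ σ ∘ to
    π→-involutive : ∀ i → π→ (π→ i) ≡ i
    π→-involutive i = ≡.trans
      (from-cong (F.trans (σ-cong (strictlyInverseˡ (σ (to i)))) (σσ≗id (to i))))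
      (strictlyInverseʳ i)
    π : Permutation′ q
    π = permutation π→ π→ π→-involutive π→-involutive

  -- The two transformations of the period function.

  summand : ∀ {n} → Character → Vector Character n → Character → Vector Carrier n →
            Carrier → K.Carrier
  summand A B C l y =
    A ⟨ y ⟩ * (C · A ⁻¹) ⟨ 1# - y ⟩ * ∏ λ i → (B i) ⁻¹ ⟨ 1# - l i F.* y ⟩

  summand-cong : ∀ {n} A (B : Vector Character n) C l {x y} → x F.≈ y →
                 summand A B C l x ≈ summand A B C l y
  summand-cong A B C l x≈y = K.*-cong
    (K.*-cong (⟨⟩-cong A x≈y) (⟨⟩-cong (C · A ⁻¹) (F.-‿cong₂ F.refl x≈y)))
    (∏.sum-cong-≋ λ i → ⟨⟩-cong (B i ⁻¹) (F.-‿cong₂ F.refl (F.*-congˡ x≈y)))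

  -- Under y ↦ 1 - y the characters A and `C · A ⁻¹` exchange arguments, and each B-factor sheds the
  -- constant `B i ⁻¹ ⟨ 1# - l i ⟩`.
  ℙᴰ-euler : ∀ {n} A C (B : Vector Character n) (l : Vector Carrier n) →
             (∀ i → ¬ (l i F.≈ 1#)) →
             ℙᴰ A B C l ≈ ∏ (λ i → B i ⁻¹ ⟨ 1# - l i ⟩) *
                          ℙᴰ (A ⁻¹ · C) B C (λ i → l i F./ (l i - 1#))
  ℙᴰ-euler A C B l l≉1 = begin
    ∑𝔽 (summand A B C l)
      ≈⟨ ∑𝔽-involution (summand-cong A B C l) (F.-‿cong₂ F.refl) F.1-[1-x]≈x ⟩
    ∑𝔽 (λ y → summand A B C l (1# - y))        ≈⟨ ∑𝔽-cong termwise ⟩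
    ∑𝔽 (λ y → P * summand (A ⁻¹ · C) B C m y)  ≈⟨ *-distribˡ-∑𝔽 P (summand (A ⁻¹ · C) B C m) ⟨
    P * ∑𝔽 (summand (A ⁻¹ · C) B C m)          ∎
    where
    open CommutativeMonoidSolver K.*-commutativeMonoid using (solve; _⊕_; _⊜_)
    P = ∏ (λ i → B i ⁻¹ ⟨ 1# - l i ⟩)
    m = λ i → l i F./ (l i - 1#)

    C-factor : ∀ y → (C · A ⁻¹) ⟨ 1# - (1# - y) ⟩ ≈ (A ⁻¹ · C) ⟨ y ⟩
    C-factor y = K.trans (⟨⟩-cong (C · A ⁻¹) (F.1-[1-x]≈x y)) (·-comm C (A ⁻¹) y)

    B-factor : ∀ y i → B i ⁻¹ ⟨ 1# - l i F.* (1# - y) ⟩ ≈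
                       B i ⁻¹ ⟨ 1# - l i ⟩ * B i ⁻¹ ⟨ 1# - m i F.* y ⟩
    B-factor y i = K.trans
      (⟨⟩-cong (B i ⁻¹) (F.sym (F.[1-l][1-l/[l-1]*y]≈1-l[1-y] (l≉1 i) y)))
      (⟨⟩-homo (B i ⁻¹) (1# - l i) (1# - m i F.* y))

    termwise : ∀ y → summand A B C l (1# - y) ≈ P * summand (A ⁻¹ · C) B C m y
    termwise y = K.trans
      (K.*-cong (K.*-cong (K.sym (χ·[ψ⁻¹·χ]⁻¹ C A (1# - y))) (C-factor y))
        (K.trans (∏.sum-cong-≋ (B-factor y))
          (∏.∑-distrib-+ (λ i → B i ⁻¹ ⟨ 1# - l i ⟩) (λ i → B i ⁻¹ ⟨ 1# - m i F.* y ⟩))))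
      (solve 4 (λ a c p b → (a ⊕ c) ⊕ (p ⊕ b) ⊜ p ⊕ ((c ⊕ a) ⊕ b)) K.refl _ _ _ _)

  -- Here k stands for 1 - l. The sum on the right is reindexed by `σ`, after which the two sides
  -- agree term by term.
  ℙᴰ-pfaff : ∀ A B C {k m} → k F.* (1# - m) F.≈ 1# →
             B ⁻¹ ⟨ k ⟩ * ℙᴰ (A ⁻¹ · C) (B ∷ []) C (m ∷ []) ≈
             A ⁻¹ ⟨ k ⟩ * ℙᴰ A (C · B ⁻¹ ∷ []) C (m ∷ [])
  ℙᴰ-pfaff A B C {k} {m} k[1-m]≈1 = begin
    B ⁻¹ ⟨ k ⟩ * ∑𝔽 f                ≈⟨ *-distribˡ-∑𝔽 (B ⁻¹ ⟨ k ⟩) f ⟩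
    ∑𝔽 (λ y → B ⁻¹ ⟨ k ⟩ * f y)      ≈⟨ ∑𝔽-cong termwise ⟩
    ∑𝔽 (λ y → A ⁻¹ ⟨ k ⟩ * g (σ y))  ≈⟨ *-distribˡ-∑𝔽 (A ⁻¹ ⟨ k ⟩) (g ∘ σ) ⟨
    A ⁻¹ ⟨ k ⟩ * ∑𝔽 (g ∘ σ)
      ≈⟨ K.*-congˡ (∑𝔽-involution (summand-cong A (E ∷ []) C (m ∷ [])) σ-cong σ-involutive) ⟨
    A ⁻¹ ⟨ k ⟩ * ∑𝔽 g                ∎
    where
    open F.Möbius m (F.x*y≈1⇒y≉0 k[1-m]≈1)
    open CommutativeMonoidSolver K.*-commutativeMonoid using (solve; _⊕_; _⊜_; id)
    D = C · A ⁻¹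
    E = C · B ⁻¹
    f = summand (A ⁻¹ · C) (B ∷ []) C (m ∷ [])
    g = summand A (E ∷ []) C (m ∷ [])

    -- The shape is a prefactor times a summand for n = 1: `c` is the only factor of `∏`, and `K.1#`
    -- is the remaining empty product.
    vanish : ∀ {a b c} → c ≈ K.0# → a * (b * (c * K.1#)) ≈ K.0#
    vanish c≈0 = K.trans
      (K.*-congˡ (K.trans (K.*-congˡ (K.trans (K.*-congʳ c≈0) (K.zeroˡ _))) (K.zeroʳ _)))
      (K.zeroʳ _)

    pole-term : ∀ {y} → denom y F.≈ 0# → B ⁻¹ ⟨ k ⟩ * f y ≈ A ⁻¹ ⟨ k ⟩ * g (σ y)
    pole-term d≈0 = K.trans (vanish (⟨⟩-zero (B ⁻¹) d≈0))
      (K.sym (vanish (⟨⟩-zero (E ⁻¹) (F.trans (denom-cong (σ-pole d≈0)) d≈0))))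

    -- Once the B-factors are rewritten by `split`, the characters regroup into quotients: (1 - y) /
    -- d is `σ` y, y / e is 1 - `σ` y, and 1 / e is `denom` (`σ` y).
    regular-term : ∀ {y} → ¬ (denom y F.≈ 0#) → B ⁻¹ ⟨ k ⟩ * f y ≈ A ⁻¹ ⟨ k ⟩ * g (σ y)
    regular-term {y} d≉0 = begin
      B ⁻¹ ⟨ k ⟩ * ((A ⁻¹ · C) ⟨ y ⟩ * (C · (A ⁻¹ · C) ⁻¹) ⟨ 1# - y ⟩ * (B ⁻¹ ⟨ d ⟩ * K.1#))
        ≈⟨ K.*-congˡ (K.*-congʳ (K.*-cong (·-comm (A ⁻¹) C y) (χ·[ψ⁻¹·χ]⁻¹ C A (1# - y)))) ⟩
      B ⁻¹ ⟨ k ⟩ * (D ⟨ y ⟩ * A ⟨ 1# - y ⟩ * (B ⁻¹ ⟨ d ⟩ * K.1#))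
        ≈⟨ solve 4 (λ bₖ x a b → bₖ ⊕ ((x ⊕ a) ⊕ (b ⊕ id)) ⊜ (a ⊕ x) ⊕ (b ⊕ bₖ)) K.refl _ _ _ _ ⟩
      A ⟨ 1# - y ⟩ * D ⟨ y ⟩ * (B ⁻¹ ⟨ d ⟩ * B ⁻¹ ⟨ k ⟩)
        ≈⟨ K.*-congˡ split ⟩
      A ⟨ 1# - y ⟩ * D ⟨ y ⟩ * ((A ⁻¹ ⟨ d ⟩ * A ⁻¹ ⟨ k ⟩) * (D ⁻¹ ⟨ e ⟩ * E ⟨ e ⟩))
        ≈⟨ solve 6 (λ a x āₖ ā δ ε → (a ⊕ x) ⊕ ((ā ⊕ āₖ) ⊕ (δ ⊕ ε)) ⊜
                                     āₖ ⊕ (((a ⊕ ā) ⊕ (x ⊕ δ)) ⊕ (ε ⊕ id))) K.refl _ _ _ _ _ _ ⟩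
      A ⁻¹ ⟨ k ⟩ * (A ⟨ 1# - y ⟩ * A ⁻¹ ⟨ d ⟩ * (D ⟨ y ⟩ * D ⁻¹ ⟨ e ⟩) * (E ⟨ e ⟩ * K.1#))
        ≈⟨ K.*-congˡ (K.*-cong (K.*-cong (⟨⟩-quotient A d≉0 (σ*denom d≉0)) (⟨⟩-quotient D e≉0 [1-σ]e≈y))
                               (K.*-congʳ (⁻¹-⟨⟩ E denom-σ*e≈1))) ⟨
      A ⁻¹ ⟨ k ⟩ * (A ⟨ σ y ⟩ * D ⟨ 1# - σ y ⟩ * (E ⁻¹ ⟨ denom (σ y) ⟩ * K.1#))  ∎
      where
      d = denom y
      -- This is the inverse of `denom` (`σ` y), because `denom` (`σ` y) * d = 1 - m and k is the
      -- inverse of 1 - m.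
      e = d F.* k

      e≉0 : ¬ (e F.≈ 0#)
      e≉0 = F.*-≉0 d≉0 (F.x*y≈1⇒x≉0 k[1-m]≈1)

      [1-m]k≈1 : (1# - m) F.* k F.≈ 1#
      [1-m]k≈1 = F.trans (F.*-comm (1# - m) k) k[1-m]≈1

      [1-σ]e≈y : (1# - σ y) F.* e F.≈ y
      [1-σ]e≈y = F.trans (F.sym (F.*-assoc (1# - σ y) d k)) (F.trans (F.*-congʳ ([1-σ]*denom d≉0))
        (F.trans (F.*-assoc y (1# - m) k) (F.trans (F.*-congˡ [1-m]k≈1) (F.*-identityʳ y))))

      denom-σ*e≈1 : denom (σ y) F.* e F.≈ 1#
      denom-σ*e≈1 = F.trans (F.sym (F.*-assoc (denom (σ y)) d k))
        (F.trans (F.*-congʳ (denom-σ d≉0)) [1-m]k≈1)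

      -- The character `B ⁻¹` factors as `A ⁻¹ · (D ⁻¹ · E)`. Only the value of `A ⁻¹` at e is
      -- separated into d and k, since its value at k is the prefactor of the target.
      split : B ⁻¹ ⟨ d ⟩ * B ⁻¹ ⟨ k ⟩ ≈ (A ⁻¹ ⟨ d ⟩ * A ⁻¹ ⟨ k ⟩) * (D ⁻¹ ⟨ e ⟩ * E ⟨ e ⟩)
      split = begin
        B ⁻¹ ⟨ d ⟩ * B ⁻¹ ⟨ k ⟩                ≈⟨ ⟨⟩-homo (B ⁻¹) d k ⟨
        B ⁻¹ ⟨ e ⟩                             ≈⟨ ψ⁻¹·[χ·ψ⁻¹]⁻¹·[χ·φ⁻¹] C A B e ⟨
        (A ⁻¹ · (D ⁻¹ · E)) ⟨ e ⟩              ≈⟨ ·-⟨⟩ (A ⁻¹) (D ⁻¹ · E) e ⟩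
        A ⁻¹ ⟨ e ⟩ * (D ⁻¹ · E) ⟨ e ⟩          ≈⟨ K.*-cong (⟨⟩-homo (A ⁻¹) d k) (·-⟨⟩ (D ⁻¹) E e) ⟩
        (A ⁻¹ ⟨ d ⟩ * A ⁻¹ ⟨ k ⟩) * (D ⁻¹ ⟨ e ⟩ * E ⟨ e ⟩)  ∎

    termwise : ∀ y → B ⁻¹ ⟨ k ⟩ * f y ≈ A ⁻¹ ⟨ k ⟩ * g (σ y)
    termwise y = case denom y F.≟ 0# of λ where
      (yes d≈0) → pole-term d≈0
      (no  d≉0) → regular-term d≉0

  -- The case n = 1, including l = 1.

  ℙᴰ-1 : ∀ A B C {l} → l F.≈ 1# → ℙᴰ A (B ∷ []) C (l ∷ []) ≈ J A (C · (A · B) ⁻¹)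
  ℙᴰ-1 A B C {l} l≈1 = ∑𝔽-cong λ y → begin
    A ⟨ y ⟩ * (C · A ⁻¹) ⟨ 1# - y ⟩ * (B ⁻¹ ⟨ 1# - l F.* y ⟩ * K.1#)
      ≈⟨ K.*-congˡ (K.trans (K.*-identityʳ _) (⟨⟩-cong (B ⁻¹)
           (F.-‿cong₂ F.refl (F.trans (F.*-congʳ l≈1) (F.*-identityˡ y))))) ⟩
    A ⟨ y ⟩ * (C · A ⁻¹) ⟨ 1# - y ⟩ * B ⁻¹ ⟨ 1# - y ⟩
      ≈⟨ K.*-assoc _ _ _ ⟩
    A ⟨ y ⟩ * ((C · A ⁻¹) ⟨ 1# - y ⟩ * B ⁻¹ ⟨ 1# - y ⟩)
      -- Merging the two characters is valid at y = 1 as well, where both sides are 0.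
      ≈⟨ K.*-congˡ (·-⟨⟩ (C · A ⁻¹) (B ⁻¹) (1# - y)) ⟨
    A ⟨ y ⟩ * (C · A ⁻¹ · B ⁻¹) ⟨ 1# - y ⟩
      ≈⟨ K.*-congˡ (⟨⟩-ext (C · A ⁻¹ · B ⁻¹) (C · (A · B) ⁻¹) (λ _ → K.*-assoc _ _ _) (1# - y)) ⟩
    A ⟨ y ⟩ * (C · (A · B) ⁻¹) ⟨ 1# - y ⟩  ∎

  ℙᴰ-euler₁ : ∀ A B C l →
    ℙᴰ A (B ∷ []) C (l ∷ []) ≈
    B ⁻¹ ⟨ 1# - l ⟩ * ℙᴰ (A ⁻¹ · C) (B ∷ []) C (l F./ (l - 1#) ∷ []) +
    δ (1# - l) * J A (C · (A · B) ⁻¹)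
  ℙᴰ-euler₁ A B C l = case (1# - l) F.≟ 0# of λ where
      -- For l = 1 the quotient in `P` takes the default value 0. The term is removed by its
      -- prefactor, a character at 0, and only the Jacobi sum remains.
      (yes 1-l≈0) → begin
        ℙᴰ A (B ∷ []) C (l ∷ [])       ≈⟨ ℙᴰ-1 A B C (F.sym (F.x-y≈0⇒x≈y 1-l≈0)) ⟩
        J′                             ≈⟨ K.*-identityˡ J′ ⟨
        K.1# * J′                      ≈⟨ K.+-identityˡ (K.1# * J′) ⟨
        K.0# + K.1# * J′               ≈⟨ K.+-congʳ (K.zeroˡ P) ⟨
        K.0# * P + K.1# * J′           ≈⟨ K.+-cong (K.*-congʳ (⟨⟩-zero (B ⁻¹) 1-l≈0)) (K.*-congʳ (δ-zero 1-l≈0)) ⟨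
        B ⁻¹ ⟨ 1# - l ⟩ * P + δ (1# - l) * J′  ∎
      (no 1-l≉0) → begin
        ℙᴰ A (B ∷ []) C (l ∷ [])
          ≈⟨ ℙᴰ-euler A C (B ∷ []) (l ∷ []) (λ { zero → F.1-x≉0⇒x≉1 1-l≉0 }) ⟩
        (B ⁻¹ ⟨ 1# - l ⟩ * K.1#) * P           ≈⟨ K.*-congʳ (K.*-identityʳ _) ⟩
        B ⁻¹ ⟨ 1# - l ⟩ * P                    ≈⟨ K.+-identityʳ _ ⟨
        B ⁻¹ ⟨ 1# - l ⟩ * P + K.0#             ≈⟨ K.+-congˡ (K.zeroˡ J′) ⟨
        B ⁻¹ ⟨ 1# - l ⟩ * P + K.0# * J′        ≈⟨ K.+-congˡ (K.*-congʳ (δ-nonzero 1-l≉0)) ⟨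
        B ⁻¹ ⟨ 1# - l ⟩ * P + δ (1# - l) * J′  ∎
    where
    J′ = J A (C · (A · B) ⁻¹)
    P = ℙᴰ (A ⁻¹ · C) (B ∷ []) C (l F./ (l - 1#) ∷ [])

  -- For l = 1 both prefactors are characters evaluated at 0, so both sides vanish. Otherwise
  -- `ℙᴰ-pfaff` applies with k = 1 - l.
  ℙᴰ-pfaff₁ : ∀ A B C l →
    B ⁻¹ ⟨ 1# - l ⟩ * ℙᴰ (A ⁻¹ · C) (B ∷ []) C (l F./ (l - 1#) ∷ []) ≈
    A ⁻¹ ⟨ 1# - l ⟩ * ℙᴰ A (C · B ⁻¹ ∷ []) C (l F./ (l - 1#) ∷ [])
  ℙᴰ-pfaff₁ A B C l = case (1# - l) F.≟ 0# of λ where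
    (yes 1-l≈0) → K.trans (K.trans (K.*-congʳ (⟨⟩-zero (B ⁻¹) 1-l≈0)) (K.zeroˡ _))
      (K.sym (K.trans (K.*-congʳ (⟨⟩-zero (A ⁻¹) 1-l≈0)) (K.zeroˡ _)))
    (no 1-l≉0) → ℙᴰ-pfaff A B C (F.[1-l][1-l/[l-1]]≈1 (F.1-x≉0⇒x≉1 1-l≉0))

-- Deciding convertibility of the instances at ℂ by unfolding ℂ (Cauchy proofs
-- included) is infeasible, so the specialization below has to agree with the
-- statement syntactically.  Hence K occurs only through parameters for its
-- operations, and names are let-bound where opening Characters 𝔽 K or
-- FiniteField 𝔽 would introduce fresh copies of them (projections are written
-- postfix for the same reason).
transformations : ∀ {c ℓ : Level} {q : ℕ} (𝔽 : FiniteField c ℓ q) (K : CommutativeRing 0ℓ 0ℓ) →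
  let module K = CommutativeRing K in
  {eq : Rel K.Carrier 0ℓ} {add mul : Op₂ K.Carrier} →
  K._≈_ ≡ eq → K._+_ ≡ add → K._*_ ≡ mul →
  let Carrier = 𝔽 .FiniteField.commutativeRing .CommutativeRing.Carrier
      1# = 𝔽 .FiniteField.commutativeRing .CommutativeRing.1#
      infix 4 _≈_
      _≈_ = 𝔽 .FiniteField.commutativeRing .CommutativeRing._≈_
      infix 4 _≈ᴷ_
      infixl 6 _-_ _+ᴷ_
      infixl 7 _*ᴷ_
      _≈ᴷ_ = eq
      _+ᴷ_ = add
      _*ᴷ_ = mul
      infixl 7 _/_ _·_
      infix 9 _⟨_⟩
      infix 10 _⁻¹
      _-_ = FiniteField._-_ 𝔽
      _/_ = FiniteField._/_ 𝔽
      Character = Characters.Character 𝔽 K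
      _·_ = Characters._·_ 𝔽 K
      _⁻¹ = Characters._⁻¹ 𝔽 K
      _⟨_⟩ = Characters._⟨_⟩ 𝔽 K
      δ = Characters.δ 𝔽 K
      ∏ = Characters.∏ 𝔽 K
      J = Characters.J 𝔽 K
      ℙᴰ = Characters.ℙᴰ 𝔽 K
  in
  (∀ (A B C : Character) (l : Carrier) →
     (ℙᴰ A (B ∷ []) C (l ∷ [])
        ≈ᴷ B ⁻¹ ⟨ 1# - l ⟩ *ᴷ ℙᴰ (A ⁻¹ · C) (B ∷ []) C (l / (l - 1#) ∷ [])
             +ᴷ δ (1# - l) *ᴷ J A (C · (A · B) ⁻¹))
     ×
     (B ⁻¹ ⟨ 1# - l ⟩ *ᴷ ℙᴰ (A ⁻¹ · C) (B ∷ []) C (l / (l - 1#) ∷ [])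
             +ᴷ δ (1# - l) *ᴷ J A (C · (A · B) ⁻¹)
        ≈ᴷ A ⁻¹ ⟨ 1# - l ⟩ *ᴷ ℙᴰ A (C · B ⁻¹ ∷ []) C (l / (l - 1#) ∷ [])
             +ᴷ δ (1# - l) *ᴷ J A (C · (A · B) ⁻¹)))
  ×
  (∀ (n : ℕ) → n ≥ 2 →
   ∀ (A C : Character) (B : Vector Character n) (l : Vector Carrier n) →
     (∀ i → ¬ (l i ≈ 1#)) →
     ℙᴰ A B C l
       ≈ᴷ ∏ (λ i → B i ⁻¹ ⟨ 1# - l i ⟩)
            *ᴷ ℙᴰ (A ⁻¹ · C) B C (λ i → l i / (l i - 1#)))
transformations 𝔽 K ≡.refl ≡.refl ≡.refl =
  -- The second equality compares the leading terms and adds the common Jacobi sum term to both.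
  (λ A B C l → ℙᴰ-euler₁ A B C l , K.+-congʳ (ℙᴰ-pfaff₁ A B C l)) ,
  (λ n _ A C B l → ℙᴰ-euler A C B l)
  where
  open CharacterSums 𝔽 K
  module K = CommutativeRing K

proposition6p5 : ∀ {c ℓ : Level} (p e : ℕ) → Prime p → ¬ (2 ∣ p) →
  (𝔽 : FiniteField c ℓ (p ^ e)) →
  let Carrier = 𝔽 .FiniteField.commutativeRing .CommutativeRing.Carrier
      1# = 𝔽 .FiniteField.commutativeRing .CommutativeRing.1#
      infix 4 _≈_
      _≈_ = 𝔽 .FiniteField.commutativeRing .CommutativeRing._≈_
      infixl 6 _-_
      infixl 7 _/_ _·_
      infix 9 _⟨_⟩
      infix 10 _⁻¹
      _-_ = FiniteField._-_ 𝔽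
      _/_ = FiniteField._/_ 𝔽
      Character = Characters.Character 𝔽 ℂ-commutativeRing
      _·_ = Characters._·_ 𝔽 ℂ-commutativeRing
      _⁻¹ = Characters._⁻¹ 𝔽 ℂ-commutativeRing
      _⟨_⟩ = Characters._⟨_⟩ 𝔽 ℂ-commutativeRing
      δ = Characters.δ 𝔽 ℂ-commutativeRing
      ∏ = Characters.∏ 𝔽 ℂ-commutativeRing
      J = Characters.J 𝔽 ℂ-commutativeRing
      ℙᴰ = Characters.ℙᴰ 𝔽 ℂ-commutativeRing
  in
  (∀ (A B C : Character) (l : Carrier) →
     (ℙᴰ A (B ∷ []) C (l ∷ [])
        ≈ℂ B ⁻¹ ⟨ 1# - l ⟩ *ℂ ℙᴰ (A ⁻¹ · C) (B ∷ []) C (l / (l - 1#) ∷ [])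
             +ℂ δ (1# - l) *ℂ J A (C · (A · B) ⁻¹))
     ×
     (B ⁻¹ ⟨ 1# - l ⟩ *ℂ ℙᴰ (A ⁻¹ · C) (B ∷ []) C (l / (l - 1#) ∷ [])
             +ℂ δ (1# - l) *ℂ J A (C · (A · B) ⁻¹)
        ≈ℂ A ⁻¹ ⟨ 1# - l ⟩ *ℂ ℙᴰ A (C · B ⁻¹ ∷ []) C (l / (l - 1#) ∷ [])
             +ℂ δ (1# - l) *ℂ J A (C · (A · B) ⁻¹)))
  ×
  (∀ (n : ℕ) → n ≥ 2 →
   ∀ (A C : Character) (B : Vector Character n) (l : Vector Carrier n) →
     (∀ i → ¬ (l i ≈ 1#)) →
     ℙᴰ A B C l
       ≈ℂ ∏ (λ i → B i ⁻¹ ⟨ 1# - l i ⟩)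
            *ℂ ℙᴰ (A ⁻¹ · C) B C (λ i → l i / (l i - 1#)))
proposition6p5 p e _ _ 𝔽 = transformations 𝔽 ℂ-commutativeRing {_≈ℂ_} {_+ℂ_} {_*ℂ_} ≡.refl ≡.refl ≡.refl
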